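{- For every integer $n \geq 3$, $\gamma_{b,2}(P_4 \square C_n) = 8\left\lfloor \frac{n}{10} \right\rfloor + c(n_{10})$, where $n_{10} \in \{0,1,\dots,9\}$ is the least residue of $n$ modulo $10$ and $c(0)=0$, $c(1)=2$, $c(2)=2$, $c(3)=3$, $c(4)=4$, $c(5)=5$, $c(6)=5$, $c(7)=6$, $c(8)=7$, $c(9)=8$.
   Context: For a graph $G$, a $2$-limited broadcast is a function $f: V(G) \to \{0,1,2\}$. A vertex $u$ hears the broadcast from $v$ if $f(v) > 0$ and $d(u,v) \leq f(v)$, where $d$ is the distance in $G$. The broadcast $f$ is dominating if every vertex of $G$ hears the broadcast from some vertex. The cost of $f$ is $\sum_{v \in V(G)} f(v)$. The $2$-limited broadcast domination number $\gamma_{b,2}(G)$ is the minimum cost of a $2$-limited dominating broadcast on $G$. $C_n$ denotes the cycle on $n$ vertices, $P_4$ the path on $4$ vertices, and $\square$ the Cartesian product of graphs. -}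

module Defs where

open import Data.Fin using (Fin; toℕ)
open import Data.List using (List; map; allFin; cartesianProduct)
open import Data.List.Membership.Propositional using (_∈_)
open import Data.List.Membership.Propositional.Properties using (∈-allFin; ∈-cartesianProduct⁺)
open import Data.List.Relation.Unary.Unique.Propositional using (Unique)
open import Data.List.Relation.Unary.Unique.Propositional.Properties using (allFin⁺; cartesianProduct⁺)
open import Data.Nat using (ℕ; suc; _≤_; _<_; s≤s)
open import Data.Nat.ListAction using (sum)
open import Data.Nat.Properties using (1+n≢n)
open import Data.Product using (_×_; _,_; ∃-syntax)
open import Data.Sum using (_⊎_; inj₁; inj₂)
open import Data.Vec using ([]; _∷_; lookup)
open import Level using (0ℓ)
open import Relation.Binary.Construct.Closure.Symmetric using (SymClosure; fwd; bwd; symmetric)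
open import Relation.Binary.Core using (Rel)
open import Relation.Binary.Definitions using (Symmetric)
open import Relation.Binary.PropositionalEquality using (_≡_; refl; sym)
open import Relation.Nullary using (¬_)

-- Finite simple graphs.  Finiteness is given by a list containing each
-- vertex exactly once.
record Graph : Set₁ where
  field
    Vertex     : Set
    _~_        : Rel Vertex 0ℓ
    ~-sym      : Symmetric _~_
    ~-irrefl   : ∀ {v} → ¬ (v ~ v)
    vertices   : List Vertex
    ∈-vertices : ∀ v → v ∈ vertices
    unique     : Unique vertices

IsLeast : (ℕ → Set) → ℕ → Set
IsLeast P m = P m × (∀ k → P k → m ≤ k)

module _ (G : Graph) where
  open Graph G

  data Walk : ℕ → Vertex → Vertex → Set where
    []  : ∀ {v} → Walk 0 v v
    _∷_ : ∀ {k u v w} → u ~ v → Walk k v w → Walk (suc k) u w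

  -- The distance is a relation rather than a function: vertices in
  -- different components are at no (finite) distance.
  IsDistance : Vertex → Vertex → ℕ → Set
  IsDistance u v = IsLeast (λ k → Walk k u v)

  Broadcast : Set
  Broadcast = Vertex → Fin 3

  Hears : Broadcast → Vertex → Vertex → Set
  Hears f u v = 0 < toℕ (f v) × ∃[ d ] (IsDistance u v d × d ≤ toℕ (f v))

  Dominating : Broadcast → Set
  Dominating f = ∀ u → ∃[ v ] Hears f u v

  cost : Broadcast → ℕ
  cost f = sum (map (λ v → toℕ (f v)) vertices)

  -- IsBroadcastDominationNumber m  stands for  γ_{b,2}(G) = m.
  IsBroadcastDominationNumber : ℕ → Set
  IsBroadcastDominationNumber = IsLeast (λ k → ∃[ f ] (Dominating f × cost f ≡ k))

Path : ℕ → Graph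
Path n = record
  { Vertex     = Fin n
  ; _~_        = SymClosure Next
  ; ~-sym      = symmetric Next
  ; ~-irrefl   = λ { (fwd e) → 1+n≢n (sym e) ; (bwd e) → 1+n≢n (sym e) }
  ; vertices   = allFin n
  ; ∈-vertices = ∈-allFin
  ; unique     = allFin⁺ n
  }
  where
  Next : Rel (Fin n) 0ℓ
  Next i j = toℕ j ≡ suc (toℕ i)

CyclicNext : ∀ {n} → Rel (Fin n) 0ℓ
CyclicNext {n} i j = toℕ j ≡ suc (toℕ i) ⊎ (suc (toℕ i) ≡ n × toℕ j ≡ 0)

Cycle : (n : ℕ) → 3 ≤ n → Graph
Cycle n 3≤n = record
  { Vertex     = Fin n
  ; _~_        = SymClosure CyclicNext
  ; ~-sym      = symmetric CyclicNext
  ; ~-irrefl   = λ { (fwd e) → irrefl 3≤n e ; (bwd e) → irrefl 3≤n e }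
  ; vertices   = allFin n
  ; ∈-vertices = ∈-allFin
  ; unique     = allFin⁺ n
  }
  where
  irrefl : ∀ {m} → 3 ≤ m → {i : Fin m} → ¬ CyclicNext i i
  irrefl _                {i} (inj₁ e)       = 1+n≢n (sym e)
  irrefl (s≤s (s≤s _))    {i} (inj₂ (e , z)) with toℕ i
  irrefl (s≤s (s≤s _))    {i} (inj₂ (() , refl)) | .0

infixr 7 _□_

_□_ : Graph → Graph → Graph
G □ H = record
  { Vertex     = G.Vertex × H.Vertex
  ; _~_        = Adj
  ; ~-sym      = λ { (inj₁ (e , h)) → inj₁ (sym e , H.~-sym h)
                   ; (inj₂ (g , e)) → inj₂ (G.~-sym g , sym e) }
  ; ~-irrefl   = λ { (inj₁ (_ , h)) → H.~-irrefl h
                   ; (inj₂ (g , _)) → G.~-irrefl g }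
  ; vertices   = cartesianProduct G.vertices H.vertices
  ; ∈-vertices = λ (u , x) → ∈-cartesianProduct⁺ (G.∈-vertices u) (H.∈-vertices x)
  ; unique     = cartesianProduct⁺ G.unique H.unique
  }
  where
  module G = Graph G
  module H = Graph H
  Adj : Rel (G.Vertex × H.Vertex) 0ℓ
  Adj (u , x) (v , y) = (u ≡ v × x H.~ y) ⊎ (u G.~ v × x ≡ y)

c : Fin 10 → ℕ
c = lookup (0 ∷ 2 ∷ 2 ∷ 3 ∷ 4 ∷ 5 ∷ 5 ∷ 6 ∷ 7 ∷ 8 ∷ [])

{-# OPTIONS --safe #-}
module Submission where

-- Lower bound.  Let pₖ and sₖ count the vertices of value 1 and 2 in row k of P₄.  The cells of each
-- row that hear a given vertex form an arc of known length, so each row gives a linear inequality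
-- n ≤ Rᵢ(p, s).  Weighting the rows by 3, 1, 1, 3 gives 8n ≤ 10·cost.  This is sharp enough except
-- when n ≡ 1 or 5 (mod 10); but 3R₁ ≡ R₀ + 3p₂ + 3s₃ (mod 4), and for odd n this (with its mirror
-- image) forces a total slack of at least 4 in the weighted inequality.
--
-- Upper bound.  An optimal broadcast for n whose first four columns are those of a fixed perfect
-- pattern of period 10 and cost 8 stays dominating when a period of the pattern is inserted, so
-- finitely many explicit broadcasts suffice.

open import Defs
open import Data.Nat using (ℕ; _+_; _*_; _≤_)
open import Data.Nat.DivMod using (_/_; _mod_)

open import Data.Bool using (if_then_else_)
open import Data.Fin using (Fin; toℕ; zero; suc; _≟_)
open import Data.Fin.Patterns using (0F; 1F; 2F; 3F; 4F; 5F; 6F; 7F; 8F; 9F)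
open import Data.Fin.Properties
  using (toℕ-fromℕ<; toℕ-injective; toℕ<n; injective⇒≤; all?; any?)
open import Data.List
  using (List; []; _∷_; _++_; length; map; concatMap; cartesianProduct; allFin; tabulate)
import Data.List as List
open import Data.List.Membership.Propositional using (_∈_; lose)
open import Data.List.Membership.Propositional.Properties using (∈-concatMap⁺)
open import Data.List.Properties using (length-++; map-++; map-∘; map-cong; map-tabulate)
open import Data.List.Relation.Unary.Any using (here; there; index)
open import Data.List.Relation.Unary.Any.Properties using (lookup-index)
open import Data.Nat
  using (zero; suc; pred; _∸_; _<_; _<?_; _≤?_; ∣_-_∣; z≤n; s≤s; s≤s⁻¹; NonZero; >-nonZero)
open import Data.Nat.DivMod
  using (_%_; m≡m%n+[m/n]*n; m%n<n; m%n%n≡m%n; n%n≡0; [m+n]%n≡m%n; [m+kn]%n≡m%n; m<n⇒m%n≡m;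
         %-distribˡ-+)
open import Data.Nat.GeneralisedArithmetic using (fold)
open import Data.Nat.ListAction using (sum)
open import Data.Nat.ListAction.Properties using (sum-++)
open import Data.Nat.Properties hiding (_≟_)
import Data.Nat.Properties as ℕ
open import Data.Nat.Tactic.RingSolver using (solve-∀)
open import Data.Product using (_×_; _,_; ∃-syntax)
import Data.Product.Properties as Product
open import Data.Sum using (_⊎_; inj₁; inj₂)
open import Data.Vec using (Vec; []; _∷_; lookup)
import Data.Vec.Properties as Vec
open import Function using (_∘_)
open import Relation.Binary.Construct.Closure.Symmetric using (SymClosure; fwd; bwd)
open import Relation.Binary.Definitions using (Decidable; DecidableEquality)
open import Relation.Binary.PropositionalEquality
open import Relation.Nullary using (Dec; does; yes; no; contradiction; _×-dec_; _⊎-dec_)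
open import Relation.Nullary.Decidable using (from-yes; map′)

-- Arithmetic of the row inequalities

%4-cong : ∀ m z a b → a + m * 4 ≡ b + z * 4 → a % 4 ≡ b % 4
%4-cong m z a b eq =
  trans (sym ([m+kn]%n≡m%n a m 4)) (trans (cong (_% 4) eq) ([m+kn]%n≡m%n b z 4))

-- Here `o₀` and `o` are the slacks of an outer and the adjacent inner row inequality. A positive
-- `o₀` or `p` already contributes 3. If both vanish, the hypothesis reads 2 + 3o ≡ 3s (mod 4),
-- which excludes the three cases with o + s ≤ 1.
residue-defect : ∀ m z o₀ p o s → 2 + 3 * o + m * 4 ≡ o₀ + 3 * p + 3 * s + z * 4 →
  2 ≤ 3 * o₀ + (3 * p + (o + s))
residue-defect m z (suc o₀) p       o             s             _  =
  ≤-trans (n≤1+n 2) (≤-trans (*-monoʳ-≤ 3 (s≤s z≤n)) (m≤m+n (3 * suc o₀) _))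
residue-defect m z zero     (suc p) o             s             _  =
  ≤-trans (n≤1+n 2) (≤-trans (*-monoʳ-≤ 3 (s≤s z≤n)) (m≤m+n (3 * suc p) _))
residue-defect m z zero     zero    (suc (suc _)) _             _  = s≤s (s≤s z≤n)
residue-defect m z zero     zero    1             (suc _)       _  = s≤s (s≤s z≤n)
residue-defect m z zero     zero    0             (suc (suc _)) _  = s≤s (s≤s z≤n)
residue-defect m z zero     zero    0             0             eq = contradiction (%4-cong m z 2 0 eq) λ ()
residue-defect m z zero     zero    0             1             eq = contradiction (%4-cong m z 2 3 eq) λ ()
residue-defect m z zero     zero    1             0             eq = contradiction (%4-cong m z 5 0 eq) λ ()

-- Number of pairs of a cell in the outer (inner) row and a vertex it hears, with pₖ and sₖ as above.
outer : (p₀ s₀ p₁ s₁ s₂ : ℕ) → ℕ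
outer p₀ s₀ p₁ s₁ s₂ = 3 * p₀ + 5 * s₀ + (p₁ + 3 * s₁) + s₂

inner : (p₀ s₀ p₁ s₁ p₂ s₂ s₃ : ℕ) → ℕ
inner p₀ s₀ p₁ s₁ p₂ s₂ s₃ = p₀ + 3 * s₀ + (3 * p₁ + 5 * s₁) + (p₂ + 3 * s₂) + s₃

-- With row weights 3, 1, 1, 3, a vertex of value 1 counts 10 in an outer row and 7 in an inner one;
-- a vertex of value 2 counts 19 and 20. The last summand on the left is the shortfall from 10 per
-- unit of cost.
weighted-rows : ∀ p₀ p₁ p₂ p₃ s₀ s₁ s₂ s₃ →
  3 * outer p₀ s₀ p₁ s₁ s₂ + inner p₀ s₀ p₁ s₁ p₂ s₂ s₃ +
  (3 * outer p₃ s₃ p₂ s₂ s₁ + inner p₃ s₃ p₂ s₂ p₁ s₁ s₀) + (s₀ + 3 * p₁ + (s₃ + 3 * p₂))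
  ≡ 10 * (p₀ + p₁ + p₂ + p₃ + 2 * (s₀ + s₁ + s₂ + s₃))
weighted-rows = unfolded
  where
  unfolded : ∀ p₀ p₁ p₂ p₃ s₀ s₁ s₂ s₃ →
    3 * (3 * p₀ + 5 * s₀ + (p₁ + 3 * s₁) + s₂) +
    (p₀ + 3 * s₀ + (3 * p₁ + 5 * s₁) + (p₂ + 3 * s₂) + s₃) +
    (3 * (3 * p₃ + 5 * s₃ + (p₂ + 3 * s₂) + s₁) +
    (p₃ + 3 * s₃ + (3 * p₂ + 5 * s₂) + (p₁ + 3 * s₁) + s₀)) + (s₀ + 3 * p₁ + (s₃ + 3 * p₂))
    ≡ 10 * (p₀ + p₁ + p₂ + p₃ + 2 * (s₀ + s₁ + s₂ + s₃))
  unfolded = solve-∀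

-- Modulo 4 the coefficients of three times `inner` and of `outer` differ only at `p₂` and `s₃`.
inner-outer : ∀ p₀ s₀ p₁ s₁ p₂ s₂ s₃ →
  3 * inner p₀ s₀ p₁ s₁ p₂ s₂ s₃ ≡
  outer p₀ s₀ p₁ s₁ s₂ + (2 * p₁ + s₀ + 3 * s₁ + 2 * s₂) * 4 + 3 * p₂ + 3 * s₃
inner-outer = unfolded
  where
  unfolded : ∀ p₀ s₀ p₁ s₁ p₂ s₂ s₃ →
    3 * (p₀ + 3 * s₀ + (3 * p₁ + 5 * s₁) + (p₂ + 3 * s₂) + s₃) ≡
    3 * p₀ + 5 * s₀ + (p₁ + 3 * s₁) + s₂ + (2 * p₁ + s₀ + 3 * s₁ + 2 * s₂) * 4 + 3 * p₂ + 3 * s₃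
  unfolded = solve-∀

-- The shortfall in `weighted-rows` splits into `s₃ + 3 * p₂` for this half and `s₀ + 3 * p₁` for
-- its mirror image, so for odd n each half gains 2 on its own.
half-defect : ∀ {n} m p₀ s₀ p₁ s₁ p₂ s₂ s₃ → n ≡ 1 + m * 2 →
  n ≤ outer p₀ s₀ p₁ s₁ s₂ → n ≤ inner p₀ s₀ p₁ s₁ p₂ s₂ s₃ →
  4 * n + 2 ≤ 3 * outer p₀ s₀ p₁ s₁ s₂ + inner p₀ s₀ p₁ s₁ p₂ s₂ s₃ + (s₃ + 3 * p₂)
half-defect m p₀ s₀ p₁ s₁ p₂ s₂ s₃ refl n≤R₀ n≤R₁
  with o₀ , eq₀ ← m≤n⇒∃[o]m+o≡n n≤R₀ | o₁ , eq₁ ← m≤n⇒∃[o]m+o≡n n≤R₁ = begin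
  4 * (1 + m * 2) + 2                                         ≤⟨ +-monoʳ-≤ (4 * (1 + m * 2)) defect ⟩
  4 * (1 + m * 2) + (3 * o₀ + (3 * p₂ + (o₁ + s₃)))           ≡⟨ collect m o₀ o₁ p₂ s₃ ⟩
  3 * (1 + m * 2 + o₀) + (1 + m * 2 + o₁) + (s₃ + 3 * p₂)
    ≡⟨ cong₂ (λ R₀ R₁ → 3 * R₀ + R₁ + (s₃ + 3 * p₂)) eq₀ eq₁ ⟩
  3 * outer p₀ s₀ p₁ s₁ s₂ + inner p₀ s₀ p₁ s₁ p₂ s₂ s₃ + (s₃ + 3 * p₂) ∎
  where
  open ≤-Reasoning
  z = 2 * p₁ + s₀ + 3 * s₁ + 2 * s₂
  collect : ∀ m o₀ o₁ p₂ s₃ → 4 * (1 + m * 2) + (3 * o₀ + (3 * p₂ + (o₁ + s₃))) ≡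
    3 * (1 + m * 2 + o₀) + (1 + m * 2 + o₁) + (s₃ + 3 * p₂)
  collect = solve-∀
  left : ∀ m o₁ → 1 + m * 2 + (2 + 3 * o₁ + m * 4) ≡ 3 * (1 + m * 2 + o₁)
  left = solve-∀
  right : ∀ m o₀ z p₂ s₃ → 1 + m * 2 + o₀ + z * 4 + 3 * p₂ + 3 * s₃ ≡
    1 + m * 2 + (o₀ + 3 * p₂ + 3 * s₃ + z * 4)
  right = solve-∀
  -- Put R₀ = n + o₀ and R₁ = n + o₁ into `inner-outer` and cancel one n = 1 + 2m; the 2n that
  -- remains on the left is 2 + 4m.
  defect : 2 ≤ 3 * o₀ + (3 * p₂ + (o₁ + s₃))
  defect = residue-defect m z o₀ p₂ o₁ s₃ (+-cancelˡ-≡ (1 + m * 2) _ _ (begin-equality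
    1 + m * 2 + (2 + 3 * o₁ + m * 4)                     ≡⟨ left m o₁ ⟩
    3 * (1 + m * 2 + o₁)                                 ≡⟨ cong (3 *_) eq₁ ⟩
    3 * inner p₀ s₀ p₁ s₁ p₂ s₂ s₃                       ≡⟨ inner-outer p₀ s₀ p₁ s₁ p₂ s₂ s₃ ⟩
    outer p₀ s₀ p₁ s₁ s₂ + z * 4 + 3 * p₂ + 3 * s₃       ≡⟨ cong (λ R → R + z * 4 + 3 * p₂ + 3 * s₃) eq₀ ⟨
    1 + m * 2 + o₀ + z * 4 + 3 * p₂ + 3 * s₃             ≡⟨ right m o₀ z p₂ s₃ ⟩
    1 + m * 2 + (o₀ + 3 * p₂ + 3 * s₃ + z * 4)         ∎))

module _ (p₀ p₁ p₂ p₃ s₀ s₁ s₂ s₃ : ℕ) where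

  private
    R₀ = outer p₀ s₀ p₁ s₁ s₂
    R₁ = inner p₀ s₀ p₁ s₁ p₂ s₂ s₃
    R₂ = inner p₃ s₃ p₂ s₂ p₁ s₁ s₀
    R₃ = outer p₃ s₃ p₂ s₂ s₁
    total = p₀ + p₁ + p₂ + p₃ + 2 * (s₀ + s₁ + s₂ + s₃)

  counting-bound : ∀ n → n ≤ R₀ → n ≤ R₁ → n ≤ R₂ → n ≤ R₃ → 8 * n + 3 * (n % 2) ≤ 10 * total
  counting-bound n n≤R₀ n≤R₁ n≤R₂ n≤R₃ with n % 2 | m≡m%n+[m/n]*n n 2 | m%n<n n 2
  ... | 0 | _ | _ = begin
    8 * n + 0                                             ≡⟨ split n ⟩
    3 * n + n + (3 * n + n) + 0
      ≤⟨ +-mono-≤ (+-mono-≤ (half n≤R₀ n≤R₁) (half n≤R₃ n≤R₂)) z≤n ⟩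
    3 * R₀ + R₁ + (3 * R₃ + R₂) + (s₀ + 3 * p₁ + (s₃ + 3 * p₂))
      ≡⟨ weighted-rows p₀ p₁ p₂ p₃ s₀ s₁ s₂ s₃ ⟩
    10 * total                                            ∎
    where
    open ≤-Reasoning
    split : ∀ n → 8 * n + 0 ≡ 3 * n + n + (3 * n + n) + 0
    split = solve-∀
    half : ∀ {a b} → n ≤ a → n ≤ b → 3 * n + n ≤ 3 * a + b
    half n≤a n≤b = +-mono-≤ (*-monoʳ-≤ 3 n≤a) n≤b
  ... | 1 | eq | _ = begin
    -- The two halves give 4; the 3 kept here is enough for the rounding in `ceiling`.
    8 * n + 3                                             ≤⟨ +-monoʳ-≤ (8 * n) (n≤1+n 3) ⟩
    8 * n + 4                                             ≡⟨ split n ⟩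
    4 * n + 2 + (4 * n + 2)
      ≤⟨ +-mono-≤ (half-defect (n / 2) p₀ s₀ p₁ s₁ p₂ s₂ s₃ eq n≤R₀ n≤R₁)
                  (half-defect (n / 2) p₃ s₃ p₂ s₂ p₁ s₁ s₀ eq n≤R₃ n≤R₂) ⟩
    3 * R₀ + R₁ + (s₃ + 3 * p₂) + (3 * R₃ + R₂ + (s₀ + 3 * p₁))
      ≡⟨ regroup (3 * R₀ + R₁) (s₃ + 3 * p₂) (3 * R₃ + R₂) (s₀ + 3 * p₁) ⟩
    3 * R₀ + R₁ + (3 * R₃ + R₂) + (s₀ + 3 * p₁ + (s₃ + 3 * p₂))
      ≡⟨ weighted-rows p₀ p₁ p₂ p₃ s₀ s₁ s₂ s₃ ⟩
    10 * total                                            ∎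
    where
    open ≤-Reasoning
    split : ∀ n → 8 * n + 4 ≡ 4 * n + 2 + (4 * n + 2)
    split = solve-∀
    regroup : ∀ a b c d → a + b + (c + d) ≡ a + c + (d + b)
    regroup = solve-∀
  ... | suc (suc _) | _ | s≤s (s≤s ())

-- `c r` is (8r + 3(r mod 2)) / 10 rounded up, and a full period adds exactly 80 to 8n. Rounding up
-- is expressed as a strict inequality against 10(K + 1).
ceiling : ∀ q (r : Fin 10) {K} → let n = toℕ r + q * 10 in
  8 * n + 3 * (n % 2) ≤ 10 * K → 8 * q + c r ≤ K
ceiling q r {K} bound = s≤s⁻¹ (*-cancelˡ-< 10 (8 * q + c r) (suc K) (begin-strict
  10 * (8 * q + c r)                                  ≡⟨ distribute q (c r) ⟩
  80 * q + 10 * c r                                   <⟨ +-monoʳ-< (80 * q) (rounding r) ⟩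
  80 * q + (8 * toℕ r + 3 * (toℕ r % 2) + 10)         ≡⟨ collect q (toℕ r) (3 * (toℕ r % 2)) ⟩
  8 * (toℕ r + q * 10) + 3 * (toℕ r % 2) + 10         ≡⟨ cong (λ e → 8 * (toℕ r + q * 10) + 3 * e + 10) same-parity ⟨
  8 * (toℕ r + q * 10) + 3 * ((toℕ r + q * 10) % 2) + 10 ≤⟨ +-monoˡ-≤ 10 bound ⟩
  10 * K + 10                                         ≡⟨ trans (+-comm (10 * K) 10) (sym (*-suc 10 K)) ⟩
  10 * suc K                                          ∎))
  where
  open ≤-Reasoning
  distribute : ∀ q c → 10 * (8 * q + c) ≡ 80 * q + 10 * c
  distribute = solve-∀
  collect : ∀ q r e → 80 * q + (8 * r + e + 10) ≡ 8 * (r + q * 10) + e + 10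
  collect = solve-∀
  -- At r = 1 this is 20 < 21, so the parity term has no room to spare.
  rounding : ∀ r → 10 * c r < 8 * toℕ r + 3 * (toℕ r % 2) + 10
  rounding = from-yes (all? λ r → 10 * c r <? 8 * toℕ r + 3 * (toℕ r % 2) + 10)
  same-parity : (toℕ r + q * 10) % 2 ≡ toℕ r % 2
  same-parity = trans (cong (λ x → (toℕ r + x) % 2) (sym (*-assoc q 5 2))) ([m+kn]%n≡m%n (toℕ r) (q * 5) 2)

-- Displacements and arcs on the cycle

module _ {n : ℕ} .{{_ : NonZero n}} where

  toℕ-mod : ∀ a → toℕ (a mod n) ≡ a % n
  toℕ-mod a = toℕ-fromℕ< (m%n<n a n)

  %⇒mod : ∀ {a} {i : Fin n} → a % n ≡ toℕ i → a mod n ≡ i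
  %⇒mod {a} eq = toℕ-injective (trans (toℕ-mod a) eq)

  toℕ-% : (i : Fin n) → toℕ i % n ≡ toℕ i
  toℕ-% i = m<n⇒m%n≡m (toℕ<n i)

  suc-% : ∀ a → suc (a % n) % n ≡ suc a % n
  suc-% a = begin
    (1 + a % n) % n           ≡⟨ %-distribˡ-+ 1 (a % n) n ⟩
    (1 % n + a % n % n) % n   ≡⟨ cong (λ r → (1 % n + r) % n) (m%n%n≡m%n a n) ⟩
    (1 % n + a % n) % n       ≡⟨ %-distribˡ-+ 1 a n ⟨
    (1 + a) % n               ∎
    where open ≡-Reasoning

  step : ∀ a → CyclicNext (a mod n) (suc a mod n)
  step a with m≤n⇒m<n∨m≡n (m%n<n a n)
  ... | inj₁ 1+r<n = inj₁ (begin
    toℕ (suc a mod n)      ≡⟨ toℕ-mod (suc a) ⟩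
    suc a % n              ≡⟨ suc-% a ⟨
    suc (a % n) % n        ≡⟨ m<n⇒m%n≡m 1+r<n ⟩
    suc (a % n)            ≡⟨ cong suc (toℕ-mod a) ⟨
    suc (toℕ (a mod n))    ∎)
    where open ≡-Reasoning
  ... | inj₂ 1+r≡n = inj₂ (trans (cong suc (toℕ-mod a)) 1+r≡n , (begin
    toℕ (suc a mod n)      ≡⟨ toℕ-mod (suc a) ⟩
    suc a % n              ≡⟨ suc-% a ⟨
    suc (a % n) % n        ≡⟨ cong (_% n) 1+r≡n ⟩
    n % n                  ≡⟨ n%n≡0 n ⟩
    0                      ∎))
    where open ≡-Reasoning

  next prev : Fin n → Fin n
  next i = suc (toℕ i) mod n
  prev i = (toℕ i + pred n) mod n

  next-unique : ∀ {i j} → CyclicNext i j → j ≡ next i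
  next-unique {i} {j} (inj₁ eq) = sym (%⇒mod (trans (cong (_% n) (sym eq)) (toℕ-% j)))
  next-unique (inj₂ (eq , j≡0)) = sym (%⇒mod (trans (cong (_% n) eq) (trans (n%n≡0 n) (sym j≡0))))

  prev-unique : ∀ {i j} → CyclicNext i j → i ≡ prev j
  prev-unique {i} {j} (inj₁ eq) = sym (%⇒mod (begin
    (toℕ j + pred n) % n        ≡⟨ cong (λ a → (a + pred n) % n) eq ⟩
    (suc (toℕ i) + pred n) % n  ≡⟨ cong (_% n) (+-suc (toℕ i) (pred n)) ⟨
    (toℕ i + suc (pred n)) % n  ≡⟨ cong (λ m → (toℕ i + m) % n) (suc-pred n) ⟩
    (toℕ i + n) % n             ≡⟨ [m+n]%n≡m%n (toℕ i) n ⟩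
    toℕ i % n                   ≡⟨ toℕ-% i ⟩
    toℕ i                       ∎))
    where open ≡-Reasoning
  prev-unique {i} {j} (inj₂ (eq , j≡0)) = sym (%⇒mod (begin
    (toℕ j + pred n) % n        ≡⟨ cong₂ (λ a m → (a + pred m) % n) j≡0 (sym eq) ⟩
    toℕ i % n                   ≡⟨ toℕ-% i ⟩
    toℕ i                       ∎))
    where open ≡-Reasoning

  next-step : ∀ i → CyclicNext i (next i)
  next-step i = subst (λ j → CyclicNext j (next i)) (%⇒mod (toℕ-% i)) (step (toℕ i))

  prev∘next : ∀ i → prev (next i) ≡ i
  prev∘next i = sym (prev-unique (next-step i))

  prev-step : ∀ i → CyclicNext (prev i) i
  prev-step i = subst (CyclicNext (prev i)) (%⇒mod (begin
    suc (toℕ i + pred n) % n    ≡⟨ cong (_% n) (+-suc (toℕ i) (pred n)) ⟨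
    (toℕ i + suc (pred n)) % n  ≡⟨ cong (λ m → (toℕ i + m) % n) (suc-pred n) ⟩
    (toℕ i + n) % n             ≡⟨ [m+n]%n≡m%n (toℕ i) n ⟩
    toℕ i % n                   ≡⟨ toℕ-% i ⟩
    toℕ i                       ∎)) (step (toℕ i + pred n))
    where open ≡-Reasoning

  next∘prev : ∀ i → next (prev i) ≡ i
  next∘prev i = sym (next-unique (prev-step i))

  -- A displacement by `s` steps in one of the two directions, which stands in for a signed integer
  -- modulo n.
  Shifted : ℕ → Fin n → Fin n → Set
  Shifted s j l = j ≡ fold l next s ⊎ j ≡ fold l prev s

  shifted-next : ∀ s {j l} → Shifted s j l → ∃[ s′ ] s′ ≤ suc s × Shifted s′ (next j) l
  shifted-next s       (inj₁ refl) = suc s , ≤-refl , inj₁ refl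
  shifted-next zero    (inj₂ refl) = 1 , ≤-refl , inj₁ refl
  shifted-next (suc s) (inj₂ refl) = s , m≤n+m s 2 , inj₂ (next∘prev _)

  shifted-prev : ∀ s {j l} → Shifted s j l → ∃[ s′ ] s′ ≤ suc s × Shifted s′ (prev j) l
  shifted-prev s       (inj₂ refl) = suc s , ≤-refl , inj₂ refl
  shifted-prev zero    (inj₁ refl) = 1 , ≤-refl , inj₂ refl
  shifted-prev (suc s) (inj₁ refl) = s , m≤n+m s 2 , inj₁ (prev∘next _)

  -- Each edge changes the displacement by one, either lengthening it or cancelling an earlier step.
  cycle-walk⇒shifted : ∀ 3≤n {k j l} → Walk (Cycle n 3≤n) k j l → ∃[ s ] s ≤ k × Shifted s j l
  cycle-walk⇒shifted 3≤n [] = 0 , z≤n , inj₁ refl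
  cycle-walk⇒shifted 3≤n (fwd e ∷ w) with s , s≤k , sh ← cycle-walk⇒shifted 3≤n w
    with s′ , s′≤1+s , sh′ ← shifted-prev s sh | refl ← prev-unique e =
    s′ , ≤-trans s′≤1+s (s≤s s≤k) , sh′
  cycle-walk⇒shifted 3≤n (bwd e ∷ w) with s , s≤k , sh ← cycle-walk⇒shifted 3≤n w
    with s′ , s′≤1+s , sh′ ← shifted-next s sh | refl ← next-unique e =
    s′ , ≤-trans s′≤1+s (s≤s s≤k) , sh′

  -- On a short cycle a cell may be listed twice; this is harmless, since the length serves only as
  -- an upper bound for the number of cells.
  arc : ℕ → Fin n → List (Fin n)
  arc zero    l = l ∷ []
  arc (suc r) l = fold l next (suc r) ∷ fold l prev (suc r) ∷ arc r l

  length-arc : ∀ r l → length (arc r l) ≡ 1 + 2 * r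
  length-arc zero    l = refl
  length-arc (suc r) l = trans (cong (2 +_) (length-arc r l)) (cong suc (sym (*-suc 2 r)))

  shifted⇒∈-arc : ∀ {s r j l} → s ≤ r → Shifted s j l → j ∈ arc r l
  shifted⇒∈-arc {zero}  {zero}  z≤n (inj₁ refl) = here refl
  shifted⇒∈-arc {zero}  {zero}  z≤n (inj₂ refl) = here refl
  shifted⇒∈-arc {s}     {suc r} s≤r sh with m≤n⇒m<n∨m≡n s≤r
  shifted⇒∈-arc s≤r sh          | inj₁ s<1+r = there (there (shifted⇒∈-arc (s≤s⁻¹ s<1+r) sh))
  shifted⇒∈-arc s≤r (inj₁ refl) | inj₂ refl = here refl
  shifted⇒∈-arc s≤r (inj₂ refl) | inj₂ refl = there (here refl)

  -- A row at vertical distance δ meets a ball of radius r in an arc of radius r - δ, and in nothing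
  -- if δ > r. Truncated subtraction would wrongly leave one cell in the latter case.
  trace : ℕ → ℕ → Fin n → List (Fin n)
  trace r       zero    l = arc r l
  trace zero    (suc δ) l = []
  trace (suc r) (suc δ) l = trace r δ l

  shifted⇒∈-trace : ∀ {s r j l} δ → δ + s ≤ r → Shifted s j l → j ∈ trace r δ l
  shifted⇒∈-trace zero    s≤r       sh = shifted⇒∈-arc s≤r sh
  shifted⇒∈-trace (suc δ) (s≤s le) sh = shifted⇒∈-trace δ le sh

  -- Value 0 is separated because such a vertex is not heard even by itself, whereas a ball of
  -- radius 0 contains its centre.
  heard : Fin 3 → ℕ → Fin n → List (Fin n)
  heard 0F        δ l = []
  heard t@(suc _) δ l = trace (toℕ t) δ l

width : ℕ → ℕ → ℕ
width r       zero    = 1 + 2 * r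
width zero    (suc δ) = 0
width (suc r) (suc δ) = width r δ

heard-width : Fin 3 → ℕ → ℕ
heard-width 0F        δ = 0
heard-width t@(suc _) δ = width (toℕ t) δ

length-trace : ∀ {n} .{{_ : NonZero n}} r δ (l : Fin n) → length (trace r δ l) ≡ width r δ
length-trace r       zero    l = length-arc r l
length-trace zero    (suc δ) l = refl
length-trace (suc r) (suc δ) l = length-trace r δ l

length-heard : ∀ {n} .{{_ : NonZero n}} t δ (l : Fin n) → length (heard t δ l) ≡ heard-width t δ
length-heard 0F        δ l = refl
length-heard t@(suc _) δ l = length-trace (toℕ t) δ l

-- Double counting of heard cells, row by row

-- Sending each element to a position where it occurs is injective, because the position determines
-- the element.
covering⇒≤length : ∀ {n} (xs : List (Fin n)) → (∀ j → j ∈ xs) → n ≤ length xs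
covering⇒≤length xs ∈xs = injective⇒≤ {f = index ∘ ∈xs} λ {i} {j} eq →
  trans (lookup-index (∈xs i)) (trans (cong (List.lookup xs) eq) (sym (lookup-index (∈xs j))))

length-concatMap : ∀ {A B : Set} (f : A → List B) xs → length (concatMap f xs) ≡ sum (map (length ∘ f) xs)
length-concatMap f []       = refl
length-concatMap f (x ∷ xs) = trans (length-++ (f x)) (cong (length (f x) +_) (length-concatMap f xs))

sum-cartesianProduct : ∀ {A B : Set} (g : A × B → ℕ) xs ys →
  sum (map g (cartesianProduct xs ys)) ≡ sum (map (λ x → sum (map (λ y → g (x , y)) ys)) xs)
sum-cartesianProduct g []       ys = refl
sum-cartesianProduct g (x ∷ xs) ys = begin
  sum (map g (map (x ,_) ys ++ cartesianProduct xs ys))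
    ≡⟨ cong sum (map-++ g (map (x ,_) ys) _) ⟩
  sum (map g (map (x ,_) ys) ++ map g (cartesianProduct xs ys))
    ≡⟨ sum-++ (map g (map (x ,_) ys)) _ ⟩
  sum (map g (map (x ,_) ys)) + sum (map g (cartesianProduct xs ys))
    ≡⟨ cong₂ _+_ (cong sum (sym (map-∘ ys))) (sum-cartesianProduct g xs ys) ⟩
  sum (map (λ y → g (x , y)) ys) + sum (map (λ x → sum (map (λ y → g (x , y)) ys)) xs) ∎
  where open ≡-Reasoning

module _ {A : Set} (f : A → Fin 3) where

  tally : Fin 3 → List A → ℕ
  tally t ys = sum (map (λ y → if does (f y ≟ t) then 1 else 0) ys)

  -- Applied both to the cost and to the arc lengths, this turns sums over vertices into linear
  -- forms in the numbers of ones and twos.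
  sum-by-value : (w : Fin 3 → ℕ) → w 0F ≡ 0 → ∀ ys →
    sum (map (w ∘ f) ys) ≡ w 1F * tally 1F ys + w 2F * tally 2F ys
  sum-by-value w w₀ [] = sym (cong₂ _+_ (*-zeroʳ (w 1F)) (*-zeroʳ (w 2F)))
  sum-by-value w w₀ (y ∷ ys) with f y
  ... | 0F = cong₂ _+_ w₀ (sum-by-value w w₀ ys)
  ... | 1F = trans (cong (w 1F +_) (sum-by-value w w₀ ys)) (lemma (w 1F) (w 2F) (tally 1F ys) (tally 2F ys))
    where
    lemma : ∀ a b p s → a + (a * p + b * s) ≡ a * (1 + p) + b * s
    lemma = solve-∀
  ... | 2F = trans (cong (w 2F +_) (sum-by-value w w₀ ys)) (lemma (w 1F) (w 2F) (tally 1F ys) (tally 2F ys))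
    where
    lemma : ∀ a b p s → b + (a * p + b * s) ≡ a * p + b * (1 + s)
    lemma = solve-∀

-- Every edge of the product moves exactly one coordinate, so the two projections share out the
-- length.
□-walk⇒walks : ∀ {G H k u v x y} → Walk (G □ H) k (u , x) (v , y) →
  ∃[ p ] ∃[ q ] p + q ≡ k × Walk G p u v × Walk H q x y
□-walk⇒walks [] = 0 , 0 , refl , [] , []
□-walk⇒walks (inj₁ (refl , e) ∷ w) with p , q , eq , wG , wH ← □-walk⇒walks w =
  p , suc q , trans (+-suc p q) (cong suc eq) , wG , e ∷ wH
□-walk⇒walks (inj₂ (e , refl) ∷ w) with p , q , eq , wG , wH ← □-walk⇒walks w =
  suc p , q , cong suc eq , e ∷ wG , wH

∣n-1+n∣≡1 : ∀ n → ∣ n - suc n ∣ ≡ 1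
∣n-1+n∣≡1 n = trans (cong (∣ n -_∣) (+-comm 1 n)) (∣m-m+n∣≡n n 1)

path-walk⇒≤ : ∀ {m k u v} → Walk (Path m) k u v → ∣ toℕ u - toℕ v ∣ ≤ k
path-walk⇒≤ {u = u} [] = ≤-reflexive (∣n-n∣≡0 (toℕ u))
path-walk⇒≤ {u = u} {v} (_∷_ {v = w} e es) =
  ≤-trans (∣-∣-triangle (toℕ u) (toℕ w) (toℕ v)) (+-mono-≤ (≤-reflexive (edge e)) (path-walk⇒≤ es))
  where
  edge : Graph._~_ (Path _) u w → ∣ toℕ u - toℕ w ∣ ≡ 1
  edge (fwd e) = trans (cong (∣ toℕ u -_∣) e) (∣n-1+n∣≡1 (toℕ u))
  edge (bwd e) = trans (∣-∣-comm (toℕ u) (toℕ w)) (trans (cong (∣ toℕ w -_∣) e) (∣n-1+n∣≡1 (toℕ w)))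

module _ {m n : ℕ} (3≤n : 3 ≤ n) where

  private
    instance
      n≢0 : NonZero n
      n≢0 = >-nonZero (≤-trans (s≤s z≤n) 3≤n)
    G = Path m □ Cycle n 3≤n
    open Graph G

  module _ (f : Broadcast G) where

    heard-in : Fin m → Vertex → List (Fin n)
    heard-in i (k , l) = heard (f (k , l)) ∣ toℕ i - toℕ k ∣ l

    -- The vertical part of a walk uses up at least the difference of the rows; what is left of the
    -- value bounds the displacement along the cycle.
    hears⇒∈-heard : ∀ {i j k l} → Hears G f (i , j) (k , l) → j ∈ heard-in i (k , l)
    hears⇒∈-heard {i} {j} {k} {l} (0<f , d , (walk , _) , d≤f) with f (k , l)
    ... | t@(suc _) with p , q , p+q≡d , wP , wC ← □-walk⇒walks walk
      with s , s≤q , sh ← cycle-walk⇒shifted 3≤n wC =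
      shifted⇒∈-trace ∣ toℕ i - toℕ k ∣ (begin
        ∣ toℕ i - toℕ k ∣ + s ≤⟨ +-mono-≤ (path-walk⇒≤ wP) s≤q ⟩
        p + q                 ≡⟨ p+q≡d ⟩
        d                     ≤⟨ d≤f ⟩
        toℕ t                 ∎) sh
      where open ≤-Reasoning

    row-tally : Fin 3 → Fin m → ℕ
    row-tally t k = tally (λ l → f (k , l)) t (allFin n)

    sum-by-rows : (w : Fin m → Fin 3 → ℕ) → (∀ k → w k 0F ≡ 0) →
      sum (map (λ (k , l) → w k (f (k , l))) vertices) ≡
      sum (map (λ k → w k 1F * row-tally 1F k + w k 2F * row-tally 2F k) (allFin m))
    sum-by-rows w w₀ = trans (sum-cartesianProduct _ (allFin m) (allFin n))
      (cong sum (map-cong (λ k → sum-by-value (λ l → f (k , l)) (w k) (w₀ k) (allFin n)) (allFin m)))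

    -- If the broadcast dominates, the arcs that all vertices cut out of row `i` together cover it,
    -- so their total length is at least n.
    row-covered : Dominating G f → ∀ i → let w = λ k t → heard-width t ∣ toℕ i - toℕ k ∣ in
      n ≤ sum (map (λ k → w k 1F * row-tally 1F k + w k 2F * row-tally 2F k) (allFin m))
    row-covered dom i = begin
      n
        ≤⟨ covering⇒≤length (concatMap (heard-in i) vertices) (λ j → let (v , h) = dom (i , j) in
             ∈-concatMap⁺ (heard-in i) (lose (∈-vertices v) (hears⇒∈-heard h))) ⟩
      length (concatMap (heard-in i) vertices)
        ≡⟨ length-concatMap (heard-in i) vertices ⟩
      sum (map (length ∘ heard-in i) vertices)
        ≡⟨ cong sum (map-cong (λ (k , l) → length-heard (f (k , l)) ∣ toℕ i - toℕ k ∣ l) vertices) ⟩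
      sum (map (λ (k , l) → heard-width (f (k , l)) ∣ toℕ i - toℕ k ∣) vertices)
        ≡⟨ sum-by-rows (λ k t → heard-width t ∣ toℕ i - toℕ k ∣) (λ _ → refl) ⟩
      sum (map (λ k → heard-width 1F ∣ toℕ i - toℕ k ∣ * row-tally 1F k
                    + heard-width 2F ∣ toℕ i - toℕ k ∣ * row-tally 2F k) (allFin m))
        ∎
      where open ≤-Reasoning

module _ {n : ℕ} (3≤n : 3 ≤ n) (f : Broadcast (Path 4 □ Cycle n 3≤n)) where
  private
    G = Path 4 □ Cycle n 3≤n
    p s : Fin 4 → ℕ
    p = row-tally 3≤n f 1F
    s = row-tally 3≤n f 2F

  cost-bound : Dominating G f → 8 * n + 3 * (n % 2) ≤ 10 * cost G f
  cost-bound dom = subst (λ K → 8 * n + 3 * (n % 2) ≤ 10 * K)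
    (sym (trans (sum-by-rows 3≤n f (λ _ → toℕ) (λ _ → refl)) (at-tallies total)))
    (counting-bound (p 0F) (p 1F) (p 2F) (p 3F) (s 0F) (s 1F) (s 2F) (s 3F) n
      (subst (n ≤_) (at-tallies row₀) (covered 0F))
      (subst (n ≤_) (at-tallies row₁) (covered 1F))
      (subst (n ≤_) (at-tallies row₂) (covered 2F))
      (subst (n ≤_) (at-tallies row₃) (covered 3F)))
    where
    at-tallies : ∀ {P : (_ _ _ _ _ _ _ _ : ℕ) → Set} →
      (∀ p₀ p₁ p₂ p₃ s₀ s₁ s₂ s₃ → P p₀ p₁ p₂ p₃ s₀ s₁ s₂ s₃) →
      P (p 0F) (p 1F) (p 2F) (p 3F) (s 0F) (s 1F) (s 2F) (s 3F)
    at-tallies lemma = lemma (p 0F) (p 1F) (p 2F) (p 3F) (s 0F) (s 1F) (s 2F) (s 3F)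
    covered = row-covered 3≤n f dom
    total : ∀ p₀ p₁ p₂ p₃ s₀ s₁ s₂ s₃ →
      1 * p₀ + 2 * s₀ + (1 * p₁ + 2 * s₁ + (1 * p₂ + 2 * s₂ + (1 * p₃ + 2 * s₃ + 0)))
      ≡ p₀ + p₁ + p₂ + p₃ + 2 * (s₀ + s₁ + s₂ + s₃)
    total = solve-∀
    -- The coefficients are arc lengths: at vertical distances 0, 1, 2, 3 they are 3, 1, 0, 0 for
    -- value 1 and 5, 3, 1, 0 for value 2.
    row₀ : ∀ p₀ p₁ p₂ p₃ s₀ s₁ s₂ s₃ →
      3 * p₀ + 5 * s₀ + (1 * p₁ + 3 * s₁ + (0 * p₂ + 1 * s₂ + (0 * p₃ + 0 * s₃ + 0)))
      ≡ 3 * p₀ + 5 * s₀ + (p₁ + 3 * s₁) + s₂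
    row₀ = solve-∀
    row₁ : ∀ p₀ p₁ p₂ p₃ s₀ s₁ s₂ s₃ →
      1 * p₀ + 3 * s₀ + (3 * p₁ + 5 * s₁ + (1 * p₂ + 3 * s₂ + (0 * p₃ + 1 * s₃ + 0)))
      ≡ p₀ + 3 * s₀ + (3 * p₁ + 5 * s₁) + (p₂ + 3 * s₂) + s₃
    row₁ = solve-∀
    row₂ : ∀ p₀ p₁ p₂ p₃ s₀ s₁ s₂ s₃ →
      0 * p₀ + 1 * s₀ + (1 * p₁ + 3 * s₁ + (3 * p₂ + 5 * s₂ + (1 * p₃ + 3 * s₃ + 0)))
      ≡ p₃ + 3 * s₃ + (3 * p₂ + 5 * s₂) + (p₁ + 3 * s₁) + s₀
    row₂ = solve-∀
    row₃ : ∀ p₀ p₁ p₂ p₃ s₀ s₁ s₂ s₃ →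
      0 * p₀ + 0 * s₀ + (0 * p₁ + 1 * s₁ + (1 * p₂ + 3 * s₂ + (3 * p₃ + 5 * s₃ + 0)))
      ≡ 3 * p₃ + 5 * s₃ + (p₂ + 3 * s₂) + s₁
    row₃ = solve-∀

-- Construction of walks and distances

module _ {G : Graph} where
  open Graph G

  infixr 5 _++ʷ_
  _++ʷ_ : ∀ {k l u v w} → Walk G k u v → Walk G l v w → Walk G (k + l) u w
  []       ++ʷ w = w
  (e ∷ es) ++ʷ w = e ∷ (es ++ʷ w)

  reverse : ∀ {k u v} → Walk G k u v → Walk G k v u
  reverse []                 = []
  reverse {suc k} {u} {v} (e ∷ es) = subst (λ l → Walk G l v u) (+-comm k 1) (reverse es ++ʷ (~-sym e ∷ []))

  trail-from-zero : (h : ℕ → Vertex) → (∀ a → h a ~ h (suc a)) → ∀ b → Walk G b (h 0) (h b)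
  trail-from-zero h e zero    = []
  trail-from-zero h e (suc b) = e 0 ∷ trail-from-zero (h ∘ suc) (e ∘ suc) b

  trail : (h : ℕ → Vertex) → (∀ a → h a ~ h (suc a)) → ∀ a b → Walk G ∣ a - b ∣ (h a) (h b)
  trail h e zero    b       = trail-from-zero h e b
  trail h e (suc a) zero    = reverse (trail-from-zero h e (suc a))
  trail h e (suc a) (suc b) = trail (h ∘ suc) (e ∘ suc) a b

  -- A distance has to be exhibited as a least length. Values are at most 2, so testing for equality
  -- and adjacency is enough: if both fail, every walk has length at least 2 and the given one is
  -- shortest.
  nearby⇒distance : DecidableEquality Vertex → Decidable _~_ →
    ∀ {k u v} → k ≤ 2 → Walk G k u v → ∃[ d ] IsDistance G u v d × d ≤ k
  nearby⇒distance _≟ᵥ_ _~?_ {k} {u} {v} k≤2 walk with u ≟ᵥ v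
  ... | yes refl = 0 , ([] , λ _ _ → z≤n) , z≤n
  ... | no u≢v with u ~? v
  ...   | yes u~v = 1 , (u~v ∷ [] , nonzero) , nonzero k walk
    where
    nonzero : ∀ l → Walk G l u v → 1 ≤ l
    nonzero zero    [] = contradiction refl u≢v
    nonzero (suc l) _  = s≤s z≤n
  ...   | no u≁v = k , (walk , minimal) , ≤-refl
    where
    minimal : ∀ l → Walk G l u v → k ≤ l
    minimal 0             []       = contradiction refl u≢v
    minimal 1             (e ∷ []) = contradiction e u≁v
    minimal (suc (suc l)) _        = ≤-trans k≤2 (s≤s (s≤s z≤n))

map-walk : ∀ {G H k u v} (h : Graph.Vertex G → Graph.Vertex H) →
  (∀ {u v} → Graph._~_ G u v → Graph._~_ H (h u) (h v)) → Walk G k u v → Walk H k (h u) (h v)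
map-walk h h~ []       = []
map-walk h h~ (e ∷ es) = h~ e ∷ map-walk h h~ es

path-suc : ∀ {n k} {i j : Fin n} → Walk (Path n) k i j → Walk (Path (suc n)) k (suc i) (suc j)
path-suc {n} = map-walk suc λ { (fwd e) → fwd (cong suc e) ; (bwd e) → bwd (cong suc e) }

path-walk-from-zero : ∀ {n} (k : Fin (suc n)) → Walk (Path (suc n)) (toℕ k) zero k
path-walk-from-zero         zero    = []
path-walk-from-zero {suc n} (suc k) = fwd refl ∷ path-suc (path-walk-from-zero k)

path-walk : ∀ {n} (i k : Fin n) → Walk (Path n) ∣ toℕ i - toℕ k ∣ i k
path-walk zero    k       = path-walk-from-zero k
path-walk (suc i) zero    = reverse (path-walk-from-zero (suc i))
path-walk (suc i) (suc k) = path-suc (path-walk i k)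

symmetric? : ∀ {A : Set} {R : A → A → Set} → Decidable R → Decidable (SymClosure R)
symmetric? R? i j = map′ (λ { (inj₁ e) → fwd e ; (inj₂ e) → bwd e })
  (λ { (fwd e) → inj₁ e ; (bwd e) → inj₂ e }) (R? i j ⊎-dec R? j i)

module _ {m n : ℕ} (3≤n : 3 ≤ n) where
  open Graph (Path m □ Cycle n 3≤n)

  _≟ᵥ_ : DecidableEquality Vertex
  _≟ᵥ_ = Product.≡-dec _≟_ _≟_

  _~?_ : Decidable _~_
  (i , j) ~? (k , l) =
    ((i ≟ k) ×-dec symmetric? cyclic? j l) ⊎-dec
    (symmetric? (λ i j → toℕ j ℕ.≟ suc (toℕ i)) i k ×-dec (j ≟ l))
    where
    cyclic? : Decidable (CyclicNext {n})
    cyclic? i j = (toℕ j ℕ.≟ suc (toℕ i)) ⊎-dec ((suc (toℕ i) ℕ.≟ n) ×-dec (toℕ j ℕ.≟ 0))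

-- Streams of columns and their broadcasts

Column : Set
Column = Vec (Fin 3) 4

value : Column → Fin 4 → ℕ
value col k = toℕ (lookup col k)

-- In a stream of columns, position 2 + j stands for column j of the cycle, so that the columns at
-- distance at most 2 from column j are the positions j, …, j + 4.
HeardFrom : (ℕ → Column) → ℕ → Fin 4 → Fin 4 → Fin 5 → Set
HeardFrom x j i k e = let t = value (x (j + toℕ e)) k in
  0 < t × ∣ toℕ i - toℕ k ∣ + ∣ 2 - toℕ e ∣ ≤ t

Covered : (ℕ → Column) → ℕ → Set
Covered x j = ∀ i → ∃[ k ] ∃[ e ] HeardFrom x j i k e

covered? : ∀ x j → Dec (Covered x j)
covered? x j = all? λ i → any? λ k → any? λ e →
  (0 <? value (x (j + toℕ e)) k) ×-dec (∣ toℕ i - toℕ k ∣ + ∣ 2 - toℕ e ∣ ≤? value (x (j + toℕ e)) k)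

-- Coverage is local: the window of column `j` ends at position j + 4.
covered-cong : ∀ {x y j} → (∀ a → a < 5 + j → x a ≡ y a) → Covered x j → Covered y j
covered-cong {x} {y} {j} x≈y cov i with k , e , heard ← cov i =
  k , e , subst (λ col → 0 < value col k × ∣ toℕ i - toℕ k ∣ + ∣ 2 - toℕ e ∣ ≤ value col k)
    (x≈y (j + toℕ e) (subst (j + toℕ e <_) (+-comm j 5) (+-monoʳ-< j (toℕ<n e)))) heard

-- The windows of columns 0 to n - 1 reach up to position n + 3, so four repeated positions close
-- the stream into a cycle.
record Circular (n : ℕ) (x : ℕ → Column) : Set where
  field
    covered : ∀ {j} → j < n → Covered x j
    wraps   : ∀ {a} → a < 4 → x (n + a) ≡ x a

row-weight : ℕ → (ℕ → Column) → Fin 4 → ℕ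
row-weight n x k = sum (tabulate {n = n} λ j → value (x (2 + toℕ j)) k)

weight : ℕ → (ℕ → Column) → ℕ
weight n x = sum (map (row-weight n x) (allFin 4))

module _ {n : ℕ} (3≤n : 3 ≤ n) (x : ℕ → Column) (circular : Circular n x) where
  open Circular circular

  private
    instance
      n≢0 : NonZero n
      n≢0 = >-nonZero (≤-trans (s≤s z≤n) 3≤n)
    G = Path 4 □ Cycle n 3≤n
    open Graph G
    2≤n = ≤-trans (n≤1+n 2) 3≤n

  broadcast : Broadcast G
  broadcast (k , j) = lookup (x (2 + toℕ j)) k

  cost-broadcast : cost G broadcast ≡ weight n x
  cost-broadcast = trans (sum-cartesianProduct _ (allFin 4) (allFin n))
    (cong sum (map-cong row (allFin 4)))
    where
    row : ∀ k → sum (map (λ j → toℕ (broadcast (k , j))) (allFin n)) ≡ row-weight n x k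
    row k = cong sum (map-tabulate (λ j → j) (λ j → toℕ (broadcast (k , j))))

  -- The cycle column at stream position `a`, that is a - 2 modulo n.
  column : ℕ → Fin n
  column a = (a + (n ∸ 2)) mod n

  column-2+ : ∀ b → column (2 + b) ≡ b mod n
  column-2+ b = toℕ-injective (begin
    toℕ (column (2 + b))     ≡⟨ toℕ-mod (2 + b + (n ∸ 2)) ⟩
    (2 + b + (n ∸ 2)) % n    ≡⟨ cong (_% n) (trans (cong (_+ (n ∸ 2)) (+-comm 2 b)) (+-assoc b 2 (n ∸ 2))) ⟩
    (b + (2 + (n ∸ 2))) % n  ≡⟨ cong (λ m → (b + m) % n) (m+[n∸m]≡n 2≤n) ⟩
    (b + n) % n              ≡⟨ [m+n]%n≡m%n b n ⟩
    b % n                    ≡⟨ toℕ-mod b ⟨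
    toℕ (b mod n)            ∎)
    where open ≡-Reasoning

  mod-small : ∀ {b} → b < n → toℕ (b mod n) ≡ b
  mod-small {b} b<n = trans (toℕ-mod b) (m<n⇒m%n≡m b<n)

  x-column-early : ∀ a → a < 2 → x (2 + toℕ (column a)) ≡ x a
  x-column-early a a<2 = begin
    x (2 + toℕ (column a))      ≡⟨ cong (λ b → x (2 + b)) (mod-small small) ⟩
    x (2 + (a + (n ∸ 2)))       ≡⟨ cong x eq ⟩
    x (n + a)                   ≡⟨ wraps (≤-trans a<2 (m≤m+n 2 2)) ⟩
    x a                         ∎
    where
    open ≡-Reasoning
    small : a + (n ∸ 2) < n
    small = subst (a + (n ∸ 2) <_) (m+[n∸m]≡n 2≤n) (+-monoˡ-< (n ∸ 2) a<2)
    eq : 2 + (a + (n ∸ 2)) ≡ n + a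
    eq = trans (cong (2 +_) (+-comm a (n ∸ 2))) (cong (_+ a) (m+[n∸m]≡n 2≤n))

  -- The broadcast is read off positions 2 to n + 1. Positions 0 and 1, and likewise n + 2 and n +
  -- 3, carry the same columns by `wraps`.
  x-column : ∀ a → a < 4 + n → x (2 + toℕ (column a)) ≡ x a
  x-column 0 _ = x-column-early 0 (s≤s z≤n)
  x-column 1 _ = x-column-early 1 (s≤s (s≤s z≤n))
  x-column (suc (suc b)) (s≤s (s≤s b<2+n)) with b <? n
  ... | yes b<n = cong (λ a → x (2 + a)) (trans (cong toℕ (column-2+ b)) (mod-small b<n))
  ... | no b≮n with m≤n⇒∃[o]m+o≡n (≮⇒≥ b≮n)
  ...   | b′ , refl = begin
    x (2 + toℕ (column (2 + (n + b′))))
      ≡⟨ cong (λ a → x (2 + toℕ a)) (column-2+ (n + b′)) ⟩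
    x (2 + toℕ ((n + b′) mod n))         ≡⟨ cong (λ a → x (2 + a)) (toℕ-mod (n + b′)) ⟩
    x (2 + (n + b′) % n)                 ≡⟨ cong (λ a → x (2 + a % n)) (+-comm n b′) ⟩
    x (2 + (b′ + n) % n)                 ≡⟨ cong (λ a → x (2 + a)) ([m+n]%n≡m%n b′ n) ⟩
    x (2 + b′ % n)                       ≡⟨ cong (λ a → x (2 + a)) (m<n⇒m%n≡m (≤-trans b′<2 2≤n)) ⟩
    x (2 + b′)                           ≡⟨ wraps (+-monoʳ-< 2 b′<2) ⟨
    x (n + (2 + b′))                     ≡⟨ cong x (trans (sym (+-assoc n 2 b′)) (cong (_+ b′) (+-comm n 2))) ⟩
    x (2 + (n + b′))                     ∎
    where
    open ≡-Reasoning
    b′<2 : b′ < 2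
    b′<2 = +-cancelˡ-< n b′ 2 (subst (n + b′ <_) (+-comm 2 n) b<2+n)

  column-walk : ∀ j e → Walk (Cycle n 3≤n) ∣ 2 - e ∣ j (column (toℕ j + e))
  column-walk j e = subst (λ u → Walk (Cycle n 3≤n) ∣ 2 - e ∣ u (column (toℕ j + e)))
    (trans (cong column (+-comm (toℕ j) 2)) (trans (column-2+ (toℕ j)) (%⇒mod (toℕ-% j))))
    (trail (λ a → column (toℕ j + a)) edge 2 e)
    where
    edge : ∀ a → Graph._~_ (Cycle n 3≤n) (column (toℕ j + a)) (column (toℕ j + suc a))
    edge a = subst (λ b → Graph._~_ (Cycle n 3≤n) (column (toℕ j + a)) (column b))
      (sym (+-suc (toℕ j) a)) (fwd (step (toℕ j + a + (n ∸ 2))))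

  -- A walk along the path and then along the cycle is no longer than the value at its end, hence
  -- has length at most 2 and bounds the distance.
  broadcast-dominating : Dominating G broadcast
  broadcast-dominating (i , j) with k , e , 0<t , reach ← covered (toℕ<n j) i =
    (k , column (toℕ j + toℕ e)) , ≤-trans 0<t (≤-reflexive same) ,
    let d , dist , d≤ = nearby⇒distance (_≟ᵥ_ 3≤n) (_~?_ 3≤n) (≤-trans reach (s≤s⁻¹ (toℕ<n _))) walk
    in d , dist , ≤-trans d≤ (≤-trans reach (≤-reflexive same))
    where
    same : value (x (toℕ j + toℕ e)) k ≡ toℕ (broadcast (k , column (toℕ j + toℕ e)))
    same = cong (λ col → value col k) (sym (x-column (toℕ j + toℕ e)
      (subst (toℕ j + toℕ e <_) (+-comm n 4) (+-mono-<-≤ (toℕ<n j) (s≤s⁻¹ (toℕ<n e))))))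
    walk : Walk G (∣ toℕ i - toℕ k ∣ + ∣ 2 - toℕ e ∣) (i , j) (k , column (toℕ j + toℕ e))
    walk = map-walk (_, j) (λ e → inj₂ (e , refl)) (path-walk i k) ++ʷ
           map-walk (k ,_) (λ e → inj₁ (refl , e)) (column-walk j (toℕ e))

-- Insertion of a period

prepend : ∀ {m} → Vec Column m → (ℕ → Column) → ℕ → Column
prepend []         x a       = x a
prepend (col ∷ _)  x zero    = col
prepend (_ ∷ cols) x (suc a) = prepend cols x a

prepend-cong : ∀ {m} (cols : Vec Column m) {x y k} → (∀ {a} → a < k → x a ≡ y a) →
  ∀ a → a < m + k → prepend cols x a ≡ prepend cols y a
prepend-cong []         x≈y a       a<k           = x≈y a<k
prepend-cong (_ ∷ _)    x≈y zero    _             = refl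
prepend-cong (_ ∷ cols) x≈y (suc a) (s≤s a<m+k) = prepend-cong cols x≈y a a<m+k

-- Three copies, because for n = 3 the positions below n + 4 reach into the third one.
cycled : ∀ {m} → Vec Column m → ℕ → Column
cycled cols = prepend cols (prepend cols (prepend cols λ _ → 0F ∷ 0F ∷ 0F ∷ 0F ∷ []))

-- The letters a to d stand for the four rows of a column.
∅ a₁ c₁ d₁ a₂ b₂ c₂ d₂ a₁d₂ b₂d₁ a₂d₁ : Column
∅    = 0F ∷ 0F ∷ 0F ∷ 0F ∷ []
a₁   = 1F ∷ 0F ∷ 0F ∷ 0F ∷ []
c₁   = 0F ∷ 0F ∷ 1F ∷ 0F ∷ []
d₁   = 0F ∷ 0F ∷ 0F ∷ 1F ∷ []
a₂   = 2F ∷ 0F ∷ 0F ∷ 0F ∷ []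
b₂   = 0F ∷ 2F ∷ 0F ∷ 0F ∷ []
c₂   = 0F ∷ 0F ∷ 2F ∷ 0F ∷ []
d₂   = 0F ∷ 0F ∷ 0F ∷ 2F ∷ []
a₁d₂ = 1F ∷ 0F ∷ 0F ∷ 2F ∷ []
b₂d₁ = 0F ∷ 2F ∷ 0F ∷ 1F ∷ []
a₂d₁ = 2F ∷ 0F ∷ 0F ∷ 1F ∷ []

-- Ones lie only in outer rows and twos only in inner rows, where `weighted-rows` has no shortfall;
-- each row has 10 pairs of a cell and a vertex it hears, one per cell.
block : Vec Column 10
block = b₂ ∷ ∅ ∷ d₁ ∷ a₁ ∷ ∅ ∷ c₂ ∷ ∅ ∷ a₁ ∷ d₁ ∷ ∅ ∷ []

-- Four positions suffice because a window of five that starts inside a preceding block overlaps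
-- what follows in at most four.
StartsLikeBlock : (ℕ → Column) → Set
StartsLikeBlock x = ∀ {a} → a < 4 → x a ≡ cycled block a

_≟ᶜ_ : DecidableEquality Column
_≟ᶜ_ = Vec.≡-dec _≟_

circular? : ∀ n x → Dec (Circular n x)
circular? n x = map′ to from (allUpTo? (covered? x) n ×-dec allUpTo? (λ a → x (n + a) ≟ᶜ x a) 4)
  where
  Conditions = (∀ {j} → j < n → Covered x j) × (∀ {a} → a < 4 → x (n + a) ≡ x a)
  to : Conditions → Circular n x
  to (cov , wr) = record { covered = cov ; wraps = wr }
  from : Circular n x → Conditions
  from circ = Circular.covered circ , Circular.wraps circ

starts? : ∀ x → Dec (StartsLikeBlock x)
starts? x = allUpTo? (λ a → x a ≟ᶜ cycled block a) 4

module _ {n : ℕ} {x : ℕ → Column} (circular : Circular n x) (starts : StartsLikeBlock x) where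
  open Circular circular

  block-starts : StartsLikeBlock (prepend block x)
  block-starts {a} a<4 =
    -- Positions below 4 lie inside the block, so the tails are compared on an empty range (k = 0).
    prepend-cong block {x} {prepend block (prepend block λ _ → ∅)} {0} (λ ()) a (≤-trans a<4 (m≤m+n 4 6))

  block-circular : Circular (10 + n) (prepend block x)
  block-circular = record
    { covered = cov
    ; wraps   = λ a<4 → trans (wraps a<4) (trans (starts a<4) (sym (block-starts a<4)))
    }
    where
    cov : ∀ {j} → j < 10 + n → Covered (prepend block x) j
    cov {j} j<10+n with j <? 10
    -- The window ends before position 14, where the stream still agrees with the repeated block; a
    -- finite check settles these columns.
    ... | yes j<10 = covered-cong {x = prepend block (cycled block)}
      (λ a a<5+j → sym (prepend-cong block {y = cycled block} starts a (≤-trans a<5+j (+-monoʳ-≤ 4 j<10))))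
      (Circular.covered (from-yes (circular? 10 (prepend block (cycled block)))) j<10)
    -- Past the block, the window is one of the old stream, moved by 10.
    ... | no j≮10 with j′ , refl ← m≤n⇒∃[o]m+o≡n (≮⇒≥ j≮10) =
      covered (+-cancelˡ-< 10 j′ n j<10+n)

  -- Weights start at position 2, so the new terms are block positions 2 to 9 and the columns `x 0`
  -- and `x 1`. As these two agree with the start of the block, a whole period is added, with weight
  -- 2 in each row.
  block-weight : weight (10 + n) (prepend block x) ≡ 8 + weight n x
  block-weight rewrite starts {0} (s≤s z≤n) | starts {1} (s≤s (s≤s z≤n)) =
    regroup (row-weight n x 0F) (row-weight n x 1F) (row-weight n x 2F) (row-weight n x 3F)
    where
    regroup : ∀ a b c d → 2 + a + (2 + b + (2 + c + (2 + d + 0))) ≡ 8 + (a + (b + (c + (d + 0))))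
    regroup = solve-∀

-- Explicit broadcasts for every residue

Solution : ℕ → ℕ → Set
Solution n m = ∃[ x ] Circular n x × weight n x ≡ m

ExtensibleSolution : ℕ → ℕ → Set
ExtensibleSolution n m = ∃[ x ] Circular n x × weight n x ≡ m × StartsLikeBlock x

solution? : ∀ n m x → Dec (Circular n x × weight n x ≡ m)
solution? n m x = circular? n x ×-dec (weight n x ℕ.≟ m)

extensible? : ∀ n m x → Dec (Circular n x × weight n x ≡ m × StartsLikeBlock x)
extensible? n m x = circular? n x ×-dec (weight n x ℕ.≟ m) ×-dec starts? x

extend : ∀ {n m} → ExtensibleSolution n m → ExtensibleSolution (10 + n) (8 + m)
extend (x , circular , weight≡ , starts) =
  prepend block x , block-circular circular starts ,
  trans (block-weight circular starts) (cong (8 +_) weight≡) , block-starts circular starts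

extend-family : ∀ {r w} → ExtensibleSolution r w → ∀ q → Solution (r + q * 10) (8 * q + w)
extend-family {r} {w} sol q = let x , circular , weight≡ , _ = iterated q in
  subst₂ Solution (+-comm (q * 10) r) (cong (_+ w) (*-comm q 8)) (x , circular , weight≡)
  where
  iterated : ∀ q → ExtensibleSolution (q * 10 + r) (q * 8 + w)
  iterated zero    = sol
  iterated (suc q) = extend (iterated q)

-- Serves residues whose family starts one period later, at 10 + r.
extend-family⁺ : ∀ r {w} → ExtensibleSolution (10 + r) (8 + w) →
  ∀ q → Solution (r + suc q * 10) (8 * suc q + w)
extend-family⁺ r {w} sol q = subst₂ Solution (shift r (q * 10)) (shift′ q w) (extend-family sol q)
  where
  shift : ∀ r a → 10 + r + a ≡ r + (10 + a)
  shift = solve-∀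
  shift′ : ∀ q w → 8 * q + (8 + w) ≡ 8 * suc q + w
  shift′ = solve-∀

-- Residues 0, 1, 2 start at 10, 11, 12, since n ≥ 3. For n = 3 and n = 6 the broadcasts given do
-- not begin like the block, so they stand alone and their families start at 13 and 16. The other
-- families start at r. All witnesses are checked by evaluation.
solution : ∀ q r → 3 ≤ toℕ r + q * 10 → Solution (toℕ r + q * 10) (8 * q + c r)
solution (suc q) 0F _ = extend-family⁺ 0 (_ , from-yes (extensible? 10 8 (cycled block))) q
solution (suc q) 1F _ = extend-family⁺ 1 (_ , from-yes (extensible? 11 10 (cycled
  (b₂ ∷ ∅ ∷ d₁ ∷ a₁ ∷ b₂ ∷ ∅ ∷ c₂ ∷ ∅ ∷ a₁ ∷ d₁ ∷ ∅ ∷ [])))) q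
solution (suc q) 2F _ = extend-family⁺ 2 (_ , from-yes (extensible? 12 10 (cycled
  (b₂ ∷ ∅ ∷ d₁ ∷ a₁ ∷ ∅ ∷ c₂ ∷ ∅ ∷ ∅ ∷ a₂ ∷ d₂ ∷ ∅ ∷ ∅ ∷ [])))) q
solution zero    3F _ = _ , from-yes (solution? 3 3 (cycled (b₂d₁ ∷ ∅ ∷ ∅ ∷ [])))
solution (suc q) 3F _ = extend-family⁺ 3 (_ , from-yes (extensible? 13 11 (cycled
  (b₂ ∷ ∅ ∷ d₁ ∷ a₁ ∷ ∅ ∷ c₂ ∷ ∅ ∷ b₂ ∷ ∅ ∷ ∅ ∷ a₁d₂ ∷ ∅ ∷ ∅ ∷ [])))) q
solution q       4F _ = extend-family (_ , from-yes (extensible? 4 4 (cycled (b₂ ∷ ∅ ∷ d₁ ∷ a₁ ∷ [])))) q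
solution q       5F _ = extend-family (_ , from-yes (extensible? 5 5 (cycled (b₂ ∷ ∅ ∷ d₁ ∷ a₁ ∷ c₁ ∷ [])))) q
solution zero    6F _ = _ , from-yes (solution? 6 5 (cycled (b₂ ∷ ∅ ∷ ∅ ∷ a₁d₂ ∷ ∅ ∷ ∅ ∷ [])))
solution (suc q) 6F _ = extend-family⁺ 6 (_ , from-yes (extensible? 16 13 (cycled
  (b₂ ∷ ∅ ∷ d₁ ∷ a₁ ∷ ∅ ∷ c₂ ∷ ∅ ∷ ∅ ∷ a₂d₁ ∷ ∅ ∷ ∅ ∷ c₂ ∷ ∅ ∷ a₁ ∷ d₁ ∷ ∅ ∷ [])))) q
solution q       7F _ = extend-family (_ , from-yes (extensible? 7 6 (cycled
  (b₂ ∷ ∅ ∷ d₁ ∷ a₁ ∷ ∅ ∷ c₂ ∷ ∅ ∷ [])))) q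
solution q       8F _ = extend-family (_ , from-yes (extensible? 8 7 (cycled
  (b₂ ∷ ∅ ∷ d₁ ∷ a₁ ∷ c₁ ∷ a₁ ∷ d₁ ∷ ∅ ∷ [])))) q
solution q       9F _ = extend-family (_ , from-yes (extensible? 9 8 (cycled
  (b₂ ∷ ∅ ∷ d₁ ∷ a₁ ∷ c₂ ∷ ∅ ∷ a₁ ∷ d₁ ∷ ∅ ∷ [])))) q
solution zero    0F ()
solution zero    1F (s≤s ())
solution zero    2F (s≤s (s≤s ()))

theorem4p9 : (n : ℕ) (3≤n : 3 ≤ n) →
    IsBroadcastDominationNumber (Path 4 □ Cycle n 3≤n) (8 * (n / 10) + c (n mod 10))
theorem4p9 n 3≤n = attained , minimal
  where
  G = Path 4 □ Cycle n 3≤n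
  γ = 8 * (n / 10) + c (n mod 10)
  n≡ : n ≡ toℕ (n mod 10) + n / 10 * 10
  n≡ = trans (m≡m%n+[m/n]*n n 10) (cong (_+ n / 10 * 10) (sym (toℕ-mod n)))
  attained : ∃[ f ] (Dominating G f × cost G f ≡ γ)
  attained with x , circular , weight≡ ← subst (λ m → Solution m γ) (sym n≡)
                  (solution (n / 10) (n mod 10) (subst (3 ≤_) n≡ 3≤n)) =
    broadcast 3≤n x circular , broadcast-dominating 3≤n x circular ,
    trans (cost-broadcast 3≤n x circular) weight≡
  minimal : ∀ k → ∃[ f ] (Dominating G f × cost G f ≡ k) → γ ≤ k
  minimal k (f , dom , refl) = ceiling (n / 10) (n mod 10)
    (subst (λ m → 8 * m + 3 * (m % 2) ≤ 10 * cost G f) n≡ (cost-bound 3≤n f dom))
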